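{- For every $n\ge 1$, let $R_n(X_1,\dots,X_n)$ be an $n$-ary relational symbol (whose arguments are monadic second-order variables). For every $n \geq 1$ there exists a $\{<,R_n\}$-sentence $\psi_n$ such that for every $\{<,R_n\}$-structure $\mathcal{M}=(\mathbb{N},<,R_n^{\mathcal{M}})$ where $R_n^{\mathcal{M}}\subseteq \mathcal{F}^n$ is a cardinality relation, we have $\mathcal{M} \models \psi_n$ iff $R_n^{\mathcal{M}}$ is definable in $(\mathbb{N},<)$.
   Context: $\mathcal{F}$ denotes the set of finite subsets of $\mathbb{N}$ and $|X|$ the cardinality of $X\in\mathcal{F}$. Formulas and sentences are those of weak monadic second-order logic (WMSO): first-order variables range over $\mathbb{N}$, monadic second-order variables range over finite subsets of $\mathbb{N}$, and atomic formulas use membership $x\in X$ and the symbols of the signature. A relation $R\subseteq\mathcal{F}^n$ is definable in a structure with domain $\mathbb{N}$ if there is a WMSO formula $\varphi(X_1,\dots,X_n)$ over its signature that holds exactly for the tuples of $R$. Here $R_n^{\mathcal{M}}$ denotes the interpretation of the symbol $R_n$ in $\mathcal{M}$, and $<$ is interpreted as the usual order of $\mathbb{N}$. A relation $R\subseteq \mathcal{F}^n$ ($n\ge 1$) is a cardinality relation if for all $X_1,\dots,X_n,Y_1,\dots,Y_n\in\mathcal{F}$ with $|X_i|=|Y_i|$ for every $i\in\{1,\dots,n\}$, we have $(X_1,\dots,X_n)\in R$ iff $(Y_1,\dots,Y_n)\in R$. -}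

module Defs where

open import Data.Fin using (Fin)
open import Data.List using (List; length)
open import Data.List.Membership.Propositional using () renaming (_∈_ to _∈ˡ_)
open import Data.List.Relation.Unary.Linked using (Linked)
open import Data.Nat using (ℕ; suc; _<_)
open import Data.Product using (Σ-syntax; ∃-syntax; _×_)
open import Data.Sum using (_⊎_)
open import Data.Vec using (Vec; []; _∷_; lookup; map)
open import Function.Bundles using (_⇔_)
open import Level using (0ℓ)
open import Relation.Binary.PropositionalEquality using (_≡_)
open import Relation.Nullary using (¬_)
open import Relation.Unary using (Pred)

-- A finite subset of ℕ is given by its strictly increasing enumeration.  This
-- is a canonical form: since proofs of Linked _<_ are unique, sets with the
-- same members are propositionally equal, and the length is the cardinality.
record FinSet : Set where
  constructor finSet
  field
    elements   : List ℕ
    increasing : Linked _<_ elements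

open FinSet public

infix 4 _∈_

_∈_ : ℕ → FinSet → Set
x ∈ X = x ∈ˡ elements X

∣_∣ : FinSet → ℕ
∣ X ∣ = length (elements X)

SetRelation : ℕ → Set₁
SetRelation n = Pred (Vec FinSet n) 0ℓ

IsCardinalityRelation : ∀ {n} → SetRelation n → Set
IsCardinalityRelation {n} R =
  ∀ (Xs Ys : Vec FinSet n) →
  (∀ i → ∣ lookup Xs i ∣ ≡ ∣ lookup Ys i ∣) →
  R Xs ⇔ R Ys

-- Every symbol takes a number of first-order arguments followed by a number of
-- set arguments.
record Signature : Set₁ where
  field
    Symbol   : Set
    foArity  : Symbol → ℕ
    setArity : Symbol → ℕ

open Signature public

-- Structures with domain ℕ.
Structure : Signature → Set₁
Structure σ =
  (r : Symbol σ) → Vec ℕ (foArity σ r) → Vec FinSet (setArity σ r) → Set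

infix  7 _∈'_
infix  6 ¬'_
infixr 5 _∧'_
infixr 4 _∨'_
infixr 3 _⇒'_

-- Formula σ f s: WMSO formulas whose free variables are among f first-order
-- and s set variables, as de Bruijn indices counted separately for each sort.
-- Equality is not primitive: for elements, x = y is ∀X (x ∈ X ⇔ y ∈ X), and
-- equality of sets is extensional.  All connectives and quantifiers are
-- primitive because they are not interdefinable under the constructive Sat.
data Formula (σ : Signature) (f s : ℕ) : Set where
  _∈'_           : Fin f → Fin s → Formula σ f s
  atom           : (r : Symbol σ) → Vec (Fin f) (foArity σ r) →
                   Vec (Fin s) (setArity σ r) → Formula σ f s
  ¬'_            : Formula σ f s → Formula σ f s
  _∧'_ _∨'_ _⇒'_ : Formula σ f s → Formula σ f s → Formula σ f s
  ∃¹ ∀¹          : Formula σ (suc f) s → Formula σ f s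
  ∃² ∀²          : Formula σ f (suc s) → Formula σ f s

Sentence : Signature → Set
Sentence σ = Formula σ 0 0

module _ {σ : Signature} (M : Structure σ) where

  Sat : ∀ {f s} → Vec ℕ f → Vec FinSet s → Formula σ f s → Set
  Sat xs Xs (x ∈' X)       = lookup xs x ∈ lookup Xs X
  Sat xs Xs (atom r ys Ys) = M r (map (lookup xs) ys) (map (lookup Xs) Ys)
  Sat xs Xs (¬' φ)         = ¬ Sat xs Xs φ
  Sat xs Xs (φ ∧' ψ)       = Sat xs Xs φ × Sat xs Xs ψ
  Sat xs Xs (φ ∨' ψ)       = Sat xs Xs φ ⊎ Sat xs Xs ψ
  Sat xs Xs (φ ⇒' ψ)       = Sat xs Xs φ → Sat xs Xs ψ
  Sat xs Xs (∃¹ φ)         = ∃[ x ] Sat (x ∷ xs) Xs φ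
  Sat xs Xs (∀¹ φ)         = ∀ x → Sat (x ∷ xs) Xs φ
  Sat xs Xs (∃² φ)         = ∃[ X ] Sat xs (X ∷ Xs) φ
  Sat xs Xs (∀² φ)         = ∀ X → Sat xs (X ∷ Xs) φ

  Definable : ∀ {n} → SetRelation n → Set
  Definable {n} R = Σ[ φ ∈ Formula σ 0 n ] (∀ Xs → Sat [] Xs φ ⇔ R Xs)

infix 2 _⊨_

_⊨_ : ∀ {σ} → Structure σ → Sentence σ → Set
M ⊨ ψ = Sat M [] [] ψ

data OrderSymbol : Set where
  less : OrderSymbol

orderSignature : Signature
orderSignature = record
  { Symbol   = OrderSymbol
  ; foArity  = λ { less → 2 }
  ; setArity = λ { less → 0 }
  }

⟨ℕ,<⟩ : Structure orderSignature
⟨ℕ,<⟩ less (x ∷ y ∷ []) [] = x < y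

data OrderRelSymbol : Set where
  less rel : OrderRelSymbol

orderRelSignature : ℕ → Signature
orderRelSignature n = record
  { Symbol   = OrderRelSymbol
  ; foArity  = λ { less → 2 ; rel → 0 }
  ; setArity = λ { less → 0 ; rel → n }
  }

⟨ℕ,<,_⟩ : ∀ {n} → SetRelation n → Structure (orderRelSignature n)
⟨ℕ,<, R ⟩ less (x ∷ y ∷ []) [] = x < y
⟨ℕ,<, R ⟩ rel  []           Xs = R Xs

{-# OPTIONS --safe #-}

-- A relation definable in (ℕ, <) is recognised by a finite automaton.  If a
-- cardinality relation is so recognised, placing the i-th set on an initial
-- segment turns |Xᵢ| into the number of iterations of a single map on states,
-- so the relation is eventually periodic in |Xᵢ|.  Conversely, a relation that
-- is eventually periodic in every cardinality is a finite Boolean combination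
-- of conditions on |Xᵢ| up to a period, which are definable by labelling
-- positions with the states of a counter.  Periodicity itself is expressible
-- with < and R alone, although addition is not: adding p to |Xᵢ| amounts to
-- passing from Xᵢ = [p, b) to [0, b).  As satisfaction is constructive, the
-- sentence must also assert R ∨ ¬ R: automata decide definable relations,
-- whereas a periodic relation need not be decidable.

module Submission where

open import Defs
open import Data.Bool using (Bool; true; false; not; _∧_; _∨_; T)
open import Data.Bool.Properties using (T?; T-∧)
open import Data.Fin using (Fin; zero; suc; combine; remQuot; funToFin; finToFun; toℕ; fromℕ<; _↑ˡ_; _↑ʳ_)
open import Data.Fin.Patterns using (0F; 1F; 2F; 3F)
open import Data.Fin.Properties using (any?; pigeonhole; remQuot-combine; finToFun-funToFin; 2↔Bool; toℕ-fromℕ<; toℕ<n) renaming (_≟_ to _≟ᶠ_)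
open import Data.Fin.Subset as Subset using (Subset; ⁅_⁆; _∪_)
open import Data.Fin.Subset.Properties using (p⊆p∪q; q⊆p∪q; p⊂q⇒∣p∣<∣q∣; ∣p∣≤n; x∈⁅x⁆; x∈⁅y⁆⇒x≡y; x∈p∪q⁻)
import Data.Fin.Subset.Properties as Subset
open import Data.List using (List; []; _∷_; filter; upTo; applyUpTo; length; allFin)
import Data.List.Membership.DecPropositional as DecMembership
open import Data.List.Membership.Propositional using () renaming (_∈_ to _∈ˡ_)
open import Data.List.Membership.Propositional.Properties using (∈-filter⁺; ∈-filter⁻; ∈-upTo⁺; ∈-upTo⁻; ∈-applyUpTo⁺; ∈-applyUpTo⁻; ∈-allFin)
open import Data.List.Properties using (length-applyUpTo; length-++; filter-++; filter-accept; filter-reject; upTo-∷ʳ)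
open import Data.List.Relation.Unary.All using () renaming (lookup to All-lookup)
open import Data.List.Relation.Unary.AllPairs using (AllPairs; []; _∷_)
open import Data.List.Relation.Unary.Any using (here; there)
import Data.List.Relation.Unary.Linked.Properties as Linked
open import Data.Nat using (ℕ; zero; suc; _+_; _*_; _∸_; _^_; _⊔_; _≤_; _<_; _≥_; z≤n; s≤s; z<s; s<s; s<s⁻¹; _≟_)
open import Data.Nat.GeneralisedArithmetic using (fold; fold-+)
open import Data.Nat.Properties
open import Data.Product using (Σ-syntax; ∃; ∃₂; ∃-syntax; _×_; _,_; proj₁; proj₂)
open import Data.Sum using (_⊎_; inj₁; inj₂; [_,_]′; map₂)
open import Data.Unit using (tt)
open import Data.Vec using (Vec; []; _∷_; _++_; lookup; map; head; tabulate; replicate; _[_]≔_)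
open import Data.Vec.Properties using (lookup-map; lookup∘tabulate; lookup⇒[]=; []=⇒lookup; lookup∘update; lookup∘update′; []≔-lookup; []≔-idempotent; []≔-commutes; tabulate-∘; tabulate-cong; tabulate∘lookup; map-[]≔; lookup-++ˡ; lookup-++ʳ)
open import Function using (_∘_; id; case_of_)
open import Function.Bundles using (_⇔_; mk⇔; Equivalence; Inverse)
open import Function.Properties.Equivalence using () renaming (refl to ⇔-refl; sym to ⇔-sym; trans to ⇔-trans)
open import Relation.Binary.Definitions using (tri<; tri≈; tri>)
open import Relation.Binary.PropositionalEquality using (_≡_; _≢_; refl; sym; trans; cong; cong₂; subst; subst₂; module ≡-Reasoning)
open import Relation.Nullary using (¬_; Dec; yes; no; does; proof; contradiction; Reflects; _×-dec_; _⊎-dec_; _because_)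
open import Relation.Nullary.Decidable using (decidable-stable; ¬?; map′; fromSum; toSum)
open import Relation.Nullary.Reflects using (fromEquivalence; det; ¬-reflects; _×-reflects_; _⊎-reflects_; _→-reflects_; T-reflects; ofʸ; ofⁿ)
open import Relation.Unary using (Decidable)

open Equivalence using (to; from)

private variable
  f s n : ℕ
  A B : Set

-- Boolean reflection and bounds of finite families

reflected : ∀ {b} → Reflects A b → T b → A
reflected (ofʸ a) _ = a

reflect : ∀ {b} → Reflects A b → A → T b
reflect (ofʸ _)  _ = tt
reflect (ofⁿ ¬a) a = ¬a a

Reflects-⇔ : ∀ {b} → A ⇔ B → Reflects A b → Reflects B b
Reflects-⇔ A⇔B r = fromEquivalence (to A⇔B ∘ reflected r) (reflect r ∘ from A⇔B)

upper-bound : (g : Fin n → ℕ) → ∃[ m ] (∀ i → g i ≤ m)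
upper-bound {zero}  g = 0 , λ ()
upper-bound {suc n} g = let m , g≤m = upper-bound (g ∘ suc) in
  g zero ⊔ m , λ { zero → m≤m⊔n _ _ ; (suc i) → ≤-trans (g≤m i) (m≤n⊔m (g zero) m) }

-- Finite sets of natural numbers

_∈?_ : ∀ x X → Dec (x ∈ X)
x ∈? X = DecMembership._∈?_ _≟_ x (elements X)

-- If the heads differed, each would lie in the tail of the other list and so exceed the other head.
sorted-unique : ∀ {xs ys} → AllPairs _<_ xs → AllPairs _<_ ys →
                (∀ {z} → z ∈ˡ xs → z ∈ˡ ys) → (∀ {z} → z ∈ˡ ys → z ∈ˡ xs) → xs ≡ ys
sorted-unique []      []      _ _ = refl
sorted-unique []      (_ ∷ _) _ ⊇ with () ← ⊇ (here refl)
sorted-unique (_ ∷ _) []      ⊆ _ with () ← ⊆ (here refl)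
sorted-unique {x ∷ xs} {y ∷ ys} (x<xs ∷ ↗xs) (y<ys ∷ ↗ys) ⊆ ⊇ =
  cong₂ _∷_ x≡y (sorted-unique ↗xs ↗ys ⊆-tail ⊇-tail)
  where
  x≡y : x ≡ y
  x≡y with ⊆ (here refl) | ⊇ (here refl)
  ... | here x≡y   | _          = x≡y
  ... | there _    | here y≡x   = sym y≡x
  ... | there x∈ys | there y∈xs =
    contradiction (All-lookup x<xs y∈xs) (<-asym (All-lookup y<ys x∈ys))
  ⊆-tail : ∀ {z} → z ∈ˡ xs → z ∈ˡ ys
  ⊆-tail z∈xs with ⊆ (there z∈xs)
  ... | here z≡y   = contradiction (trans x≡y (sym z≡y)) (<⇒≢ (All-lookup x<xs z∈xs))
  ... | there z∈ys = z∈ys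
  ⊇-tail : ∀ {z} → z ∈ˡ ys → z ∈ˡ xs
  ⊇-tail z∈ys with ⊇ (there z∈ys)
  ... | here z≡x   = contradiction (sym (trans z≡x x≡y)) (<⇒≢ (All-lookup y<ys z∈ys))
  ... | there z∈xs = z∈xs

card-cong : ∀ X Y → (∀ x → x ∈ X ⇔ x ∈ Y) → ∣ X ∣ ≡ ∣ Y ∣
card-cong X Y X≐Y = cong length
  (sorted-unique (Linked.Linked⇒AllPairs <-trans (increasing X))
                 (Linked.Linked⇒AllPairs <-trans (increasing Y))
                 (to (X≐Y _)) (from (X≐Y _)))

segment : ℕ → ℕ → FinSet
segment a k = finSet (applyUpTo (a +_) k)
                     (Linked.applyUpTo⁺₂ (a +_) k λ i → +-monoʳ-< a (n<1+n i))

card-segment : ∀ a k → ∣ segment a k ∣ ≡ k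
card-segment a k = length-applyUpTo (a +_) k

∈-segment : ∀ {a k x} → x ∈ segment a k ⇔ (a ≤ x × x < a + k)
∈-segment {a} {k} {x} = mk⇔ to′ from′
  where
  to′ : x ∈ segment a k → a ≤ x × x < a + k
  to′ x∈ with i , i<k , refl ← ∈-applyUpTo⁻ (a +_) x∈ = m≤m+n a i , +-monoʳ-< a i<k
  from′ : a ≤ x × x < a + k → x ∈ segment a k
  from′ (a≤x , x<a+k) = subst (_∈ segment a k) (m+[n∸m]≡n a≤x)
    (∈-applyUpTo⁺ (a +_) (+-cancelˡ-< a _ _ (subst (_< a + k) (sym (m+[n∸m]≡n a≤x)) x<a+k)))

fromBits : (ℕ → Bool) → ℕ → FinSet
fromBits u k = finSet (filter (T? ∘ u) (upTo k))
                      (Linked.filter⁺ (T? ∘ u) <-trans (Linked.applyUpTo⁺₂ id k n<1+n))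

∈-fromBits : ∀ u k {x} → x ∈ fromBits u k ⇔ (x < k × T (u x))
∈-fromBits u k = mk⇔
  (λ x∈ → let x∈upTo , ux = ∈-filter⁻ (T? ∘ u) x∈ in ∈-upTo⁻ x∈upTo , ux)
  (λ (x<k , ux) → ∈-filter⁺ (T? ∘ u) (∈-upTo⁺ x<k) ux)

Below : ℕ → FinSet → Set
Below k X = ∀ x → x ∈ X → x < k

below : ∀ X → ∃[ k ] Below k X
below X = bound (elements X)
  where
  bound : ∀ xs → ∃[ k ] (∀ x → x ∈ˡ xs → x < k)
  bound []       = 0 , λ _ ()
  bound (x ∷ xs) = let k , xs<k = bound xs in
    suc x ⊔ k , λ { _ (here refl) → m≤m⊔n (suc x) k
                  ; y (there y∈)  → ≤-trans (xs<k y y∈) (m≤n⊔m (suc x) k) }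

-- Finite automata

-- A retract of some `Fin size`: `encode` is injective, while several codes may decode to the same
-- element.
record Finite (Q : Set) : Set where
  field
    size          : ℕ
    encode        : Q → Fin size
    decode        : Fin size → Q
    decode-encode : ∀ q → decode (encode q) ≡ q

open Finite

Bool-finite : Finite Bool
Bool-finite = record
  { size = 2 ; encode = Inverse.from 2↔Bool ; decode = Inverse.to 2↔Bool
  ; decode-encode = Inverse.strictlyInverseˡ 2↔Bool }

×-finite : Finite A → Finite B → Finite (A × B)
×-finite finA finB = record
  { size          = size finA * size finB
  ; encode        = λ (a , b) → combine (encode finA a) (encode finB b)
  ; decode        = λ k → let i , j = remQuot (size finB) k in decode finA i , decode finB j
  ; decode-encode = λ (a , b) →
      trans (cong (λ (i , j) → decode finA i , decode finB j) (remQuot-combine (encode finA a) _))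
            (cong₂ _,_ (decode-encode finA a) (decode-encode finB b))
  }

Subset-finite : ∀ n → Finite (Subset n)
Subset-finite zero    = record
  { size = 1 ; encode = λ _ → zero ; decode = λ _ → [] ; decode-encode = λ { [] → refl } }
Subset-finite (suc n) = record
  { size          = size finite
  ; encode        = λ { (b ∷ S) → encode finite (b , S) }
  ; decode        = λ k → let b , S = decode finite k in b ∷ S
  ; decode-encode = λ { (b ∷ S) → cong (λ (b , S) → b ∷ S) (decode-encode finite (b , S)) }
  }
  where finite = ×-finite Bool-finite (Subset-finite n)

record DFA (L : Set) : Set₁ where
  field
    State  : Set
    finite : Finite State
    start  : State
    step   : L → State → State
    final  : State → Bool

open DFA

module _ {L : Set} where

  -- Letters are read from position n - 1 down to position 0, so that padding
  -- a word with positions above n only affects the state it starts from.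
  run : (𝔸 : DFA L) → (ℕ → L) → ℕ → State 𝔸
  run 𝔸 w zero    = start 𝔸
  run 𝔸 w (suc n) = step 𝔸 (w 0) (run 𝔸 (w ∘ suc) n)

  accept : DFA L → (ℕ → L) → ℕ → Bool
  accept 𝔸 w n = final 𝔸 (run 𝔸 w n)

  run-cong : ∀ 𝔸 {v w} n → (∀ k → k < n → v k ≡ w k) → run 𝔸 v n ≡ run 𝔸 w n
  run-cong 𝔸 zero    v≗w = refl
  run-cong 𝔸 (suc n) v≗w =
    cong₂ (step 𝔸) (v≗w 0 z<s) (run-cong 𝔸 n λ k k<n → v≗w (suc k) (s<s k<n))

  complement : DFA L → DFA L
  complement 𝔸 = record { DFA 𝔸 ; final = not ∘ final 𝔸 }

  accept-complement : ∀ 𝔸 w n → accept (complement 𝔸) w n ≡ not (accept 𝔸 w n)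
  accept-complement 𝔸 w n = cong (not ∘ final 𝔸) (run-complement w n)
    where
    run-complement : ∀ w n → run (complement 𝔸) w n ≡ run 𝔸 w n
    run-complement w zero    = refl
    run-complement w (suc n) = cong (step 𝔸 (w 0)) (run-complement (w ∘ suc) n)

  product : (Bool → Bool → Bool) → DFA L → DFA L → DFA L
  product _∙_ 𝔸 𝔹 = record
    { State  = State 𝔸 × State 𝔹
    ; finite = ×-finite (finite 𝔸) (finite 𝔹)
    ; start  = start 𝔸 , start 𝔹
    ; step   = λ a (p , q) → step 𝔸 a p , step 𝔹 a q
    ; final  = λ (p , q) → final 𝔸 p ∙ final 𝔹 q
    }

  accept-product : ∀ _∙_ 𝔸 𝔹 w n →
                   accept (product _∙_ 𝔸 𝔹) w n ≡ accept 𝔸 w n ∙ accept 𝔹 w n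
  accept-product _∙_ 𝔸 𝔹 w n = cong (λ (p , q) → final 𝔸 p ∙ final 𝔹 q) (run-product w n)
    where
    run-product : ∀ w n → run (product _∙_ 𝔸 𝔹) w n ≡ (run 𝔸 w n , run 𝔹 w n)
    run-product w zero    = refl
    run-product w (suc n) =
      cong (λ (p , q) → step 𝔸 (w 0) p , step 𝔹 (w 0) q) (run-product (w ∘ suc) n)

  Occurs : (L → Bool) → (ℕ → L) → ℕ → Set
  Occurs b w n = ∃[ k ] k < n × T (b (w k))

  Precedes : (L → Bool) → (L → Bool) → (ℕ → L) → ℕ → Set
  Precedes a b w n = ∃₂ λ j k → j < k × k < n × T (a (w j)) × T (b (w k))

  -- Words are read downwards, so the first bit says that `b` was met at a higher position. An `a`
  -- met while that bit is set therefore precedes some `b`, and the second bit remembers this.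
  scan : (a b : L → Bool) → (Bool × Bool → Bool) → DFA L
  scan a b out = record
    { State  = Bool × Bool
    ; finite = ×-finite Bool-finite Bool-finite
    ; start  = false , false
    ; step   = λ x (p , q) → b x ∨ p , (a x ∧ p) ∨ q
    ; final  = out
    }

  module _ (a b : L → Bool) (out : Bool × Bool → Bool) where

    scan-occurs : ∀ w n → Reflects (Occurs b w n) (proj₁ (run (scan a b out) w n))
    scan-occurs w zero    = ofⁿ λ ()
    scan-occurs w (suc n) = Reflects-⇔
      (mk⇔ [ (λ bw → 0 , z<s , bw) , (λ (k , k<n , bw) → suc k , s<s k<n , bw) ]′
           λ { (zero , _ , bw) → inj₁ bw ; (suc k , k<n , bw) → inj₂ (k , s<s⁻¹ k<n , bw) })
      (T-reflects (b (w 0)) ⊎-reflects scan-occurs (w ∘ suc) n)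

    scan-precedes : ∀ w n → Reflects (Precedes a b w n) (proj₂ (run (scan a b out) w n))
    scan-precedes w zero    = ofⁿ λ ()
    scan-precedes w (suc n) = Reflects-⇔
      (mk⇔ [ (λ (aw , k , k<n , bw) → 0 , suc k , z<s , s<s k<n , aw , bw)
           , (λ (j , k , j<k , k<n , abw) → suc j , suc k , s<s j<k , s<s k<n , abw) ]′
           λ { (zero , suc k , _ , k<n , aw , bw) → inj₁ (aw , k , s<s⁻¹ k<n , bw)
             ; (suc j , suc k , j<k , k<n , abw) → inj₂ (j , k , s<s⁻¹ j<k , s<s⁻¹ k<n , abw) })
      ((T-reflects (a (w 0)) ×-reflects scan-occurs (w ∘ suc) n)
        ⊎-reflects scan-precedes (w ∘ suc) n)

-- Projection of automata by the subset construction

comprehension : {P : Fin n → Set} → Decidable P → Subset n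
comprehension P? = tabulate (does ∘ P?)

∈-comprehension : {P : Fin n → Set} (P? : Decidable P) →
                  ∀ i → i Subset.∈ comprehension P? ⇔ P i
∈-comprehension P? i = mk⇔
  (λ i∈ → reflected (proof (P? i)) (subst T (trans (sym ([]=⇒lookup i∈)) (lookup∘tabulate _ i)) tt))
  (λ Pi → lookup⇒[]= i _ (trans (lookup∘tabulate _ i) (det (proof (P? i)) (ofʸ Pi))))

any-bool? : {P : Bool → Set} → (∀ b → Dec (P b)) → Dec (∃ P)
any-bool? P? = map′ [ (false ,_) , (true ,_) ]′
                    (λ { (false , p) → inj₁ p ; (true , p) → inj₂ p })
                    (P? false ⊎-dec P? true)

-- Turns reachability by some word, a property quantifying over infinitely many words, into
-- membership in a finite subset, which is decidable.
record Closure {q} (g : Bool → Fin q → Fin q) (P : Fin q → Set) (i₀ : Fin q) : Set where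
  field
    set    : Subset q
    origin : i₀ Subset.∈ set
    closed : ∀ b {i} → i Subset.∈ set → g b i Subset.∈ set
    sound  : ∀ {i} → i Subset.∈ set → P i

-- Missing successors are added one at a time. Each addition enlarges the set, whose size is at most
-- `q`; by the invariant `q ≤ ∣ S ∣ + fuel`, the fuel cannot be exhausted while a successor is still
-- missing.
closure : ∀ {q} (g : Bool → Fin q → Fin q) (P : Fin q → Set) →
          (∀ b {i} → P i → P (g b i)) → ∀ {i₀} → P i₀ → Closure g P i₀
closure {q} g P P-step {i₀} P₀ = grow q ⁅ i₀ ⁆ (m≤n+m q _) (x∈⁅x⁆ i₀)
  λ i∈ → subst P (sym (x∈⁅y⁆⇒x≡y i₀ i∈)) P₀
  where
  grow : ∀ fuel S → q ≤ Subset.∣ S ∣ + fuel → i₀ Subset.∈ S →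
         (∀ {i} → i Subset.∈ S → P i) → Closure g P i₀
  grow fuel S enough i₀∈S S⊆P
    with any? (λ i → (i Subset.∈? S) ×-dec any-bool? λ b → ¬? (g b i Subset.∈? S))
  ... | no none = record
    { set = S ; origin = i₀∈S ; sound = S⊆P
    ; closed = λ b {i} i∈S → decidable-stable (g b i Subset.∈? S) λ ∉S → none (i , i∈S , b , ∉S) }
  ... | yes (i , i∈S , b , j∉S) = continue fuel enough
    where
    S′ = S ∪ ⁅ g b i ⁆
    ∣S∣<∣S′∣ : Subset.∣ S ∣ < Subset.∣ S′ ∣
    ∣S∣<∣S′∣ = p⊂q⇒∣p∣<∣q∣ {p = S} (p⊆p∪q _ , g b i , q⊆p∪q S _ (x∈⁅x⁆ _) , j∉S)
    continue : ∀ fuel → q ≤ Subset.∣ S ∣ + fuel → Closure g P i₀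
    continue zero    enough = contradiction
      (<-≤-trans ∣S∣<∣S′∣ (≤-trans (∣p∣≤n S′) (≤-trans enough (≤-reflexive (+-identityʳ _)))))
      (<-irrefl refl)
    continue (suc fuel) enough = grow fuel S′
      (≤-trans enough (≤-trans (≤-reflexive (+-suc _ fuel)) (+-monoˡ-≤ fuel ∣S∣<∣S′∣)))
      (p⊆p∪q _ i₀∈S)
      λ j∈S′ → [ S⊆P , (λ j∈ → subst P (sym (x∈⁅y⁆⇒x≡y _ j∈)) (P-step b (S⊆P i∈S))) ]′
                 (x∈p∪q⁻ S _ j∈S′)

cons : A → (ℕ → A) → ℕ → A
cons a w zero    = a
cons a w (suc k) = w k

-- Determinises the automaton that guesses the erased track, by running on sets of codes of states
-- of `𝔸`.
module Projection {L L′ : Set} (extend : Bool → L → L′) (blank : L) (𝔸 : DFA L′) where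

  private
    q   = size (finite 𝔸)
    enc = encode (finite 𝔸)
    dec = decode (finite 𝔸)

  track : (ℕ → Bool) → (ℕ → L) → ℕ → L′
  track u w k = extend (u k) (w k)

  move : L → Bool → Fin q → Fin q
  move a b i = enc (step 𝔸 (extend b a) (dec i))

  move-enc : ∀ a b p → move a b (enc p) ≡ enc (step 𝔸 (extend b a) p)
  move-enc a b p = cong (enc ∘ step 𝔸 (extend b a)) (decode-encode (finite 𝔸) p)

  Reachable : Fin q → Set
  Reachable i = ∃₂ λ u m → i ≡ enc (run 𝔸 (track u λ _ → blank) m)

  -- A witness may extend beyond the length of the word, where all letters are blank. Those
  -- positions are read first, so every guess on them is absorbed into the initial set.
  initial : Closure (move blank) Reachable (enc (start 𝔸))
  initial = closure (move blank) Reachable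
    (λ { b (u , m , refl) → cons b u , suc m , move-enc blank b _ })
    ((λ _ → false) , 0 , refl)

  open Closure initial

  successor? : ∀ a S → Decidable (λ j → ∃[ i ] i Subset.∈ S × ∃[ b ] j ≡ move a b i)
  successor? a S j = any? λ i → (i Subset.∈? S) ×-dec any-bool? λ b → j ≟ᶠ move a b i

  accepting? : ∀ S → Dec (∃[ i ] i Subset.∈ S × T (final 𝔸 (dec i)))
  accepting? S = any? λ i → (i Subset.∈? S) ×-dec T? (final 𝔸 (dec i))

  project : DFA L
  project = record
    { State  = Subset q
    ; finite = Subset-finite q
    ; start  = set
    ; step   = λ a S → comprehension (successor? a S)
    ; final  = λ S → does (accepting? S)
    }

  BlankFrom : ℕ → (ℕ → L) → Set
  BlankFrom n w = ∀ k → n ≤ k → w k ≡ blank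

  run-sound : ∀ w n → BlankFrom n w → ∀ {i} → i Subset.∈ run project w n →
              ∃₂ λ u m → n ≤ m × i ≡ enc (run 𝔸 (track u w) m)
  run-sound w zero blanks i∈ with u , m , refl ← sound i∈ =
    u , m , z≤n , cong enc (run-cong 𝔸 m λ k _ → cong (extend (u k)) (sym (blanks k z≤n)))
  run-sound w (suc n) blanks i∈
    with j , j∈ , b , refl ← to (∈-comprehension (successor? (w 0) _) _) i∈
    with u , m , n≤m , refl ← run-sound (w ∘ suc) n (λ k n≤k → blanks (suc k) (s≤s n≤k)) j∈ =
    cons b u , suc m , s≤s n≤m , move-enc (w 0) b _

  run-complete : ∀ w n → BlankFrom n w → ∀ u m → n ≤ m →
                 enc (run 𝔸 (track u w) m) Subset.∈ run project w n
  run-complete w zero    blanks u zero    _ = origin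
  -- Here the whole word is blank, so the guess at position 0 is one more blank move inside the
  -- closed initial set.
  run-complete w zero    blanks u (suc m) _ = subst (Subset._∈ set)
    (trans (move-enc blank (u 0) p)
           (cong (λ a → enc (step 𝔸 (extend (u 0) a) p)) (sym (blanks 0 z≤n))))
    (closed (u 0) (run-complete (w ∘ suc) 0 (λ k _ → blanks (suc k) z≤n) (u ∘ suc) m z≤n))
    where p = run 𝔸 (track (u ∘ suc) (w ∘ suc)) m
  run-complete w (suc n) blanks u (suc m) (s≤s n≤m) = from (∈-comprehension (successor? (w 0) _) _)
    (_ , run-complete (w ∘ suc) n (λ k n≤k → blanks (suc k) (s≤s n≤k)) (u ∘ suc) m n≤m
       , u 0 , sym (move-enc (w 0) (u 0) _))

  accept-project : ∀ w n → BlankFrom n w → T (accept project w n) ⇔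
                   (∃₂ λ u m → n ≤ m × T (accept 𝔸 (track u w) m))
  accept-project w n blanks = mk⇔ to′ from′
    where
    to′ : T (accept project w n) → ∃₂ λ u m → n ≤ m × T (accept 𝔸 (track u w) m)
    to′ acc with i , i∈ , fin ← reflected (proof (accepting? (run project w n))) acc
            with u , m , n≤m , refl ← run-sound w n blanks i∈ =
      u , m , n≤m , subst (T ∘ final 𝔸) (decode-encode (finite 𝔸) _) fin
    from′ : (∃₂ λ u m → n ≤ m × T (accept 𝔸 (track u w) m)) → T (accept project w n)
    from′ (u , m , n≤m , acc) = reflect (proof (accepting? (run project w n)))
      (_ , run-complete w n blanks u m n≤m
         , subst (T ∘ final 𝔸) (sym (decode-encode (finite 𝔸) _)) acc)

-- From formulas over (ℕ, <) to automata

Letter : ℕ → ℕ → Set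
Letter f s = Vec Bool f × Vec Bool s

letter : Vec ℕ f → Vec FinSet s → ℕ → Letter f s
letter xs Xs k = map (λ x → does (k ≟ x)) xs , map (λ X → does (k ∈? X)) Xs

Bounded : ℕ → Vec ℕ f → Vec FinSet s → Set
Bounded n xs Xs = (∀ i → lookup xs i < n) × (∀ j → Below n (lookup Xs j))

letter-blank : ∀ (xs : Vec ℕ f) (Xs : Vec FinSet s) → Bounded n xs Xs → ∀ k → n ≤ k →
               letter xs Xs k ≡ (replicate f false , replicate s false)
letter-blank {n = n} xs Xs (xs<n , Xs<n) k n≤k = cong₂ _,_ (zeros¹ xs xs<n) (zeros² Xs Xs<n)
  where
  zeros¹ : ∀ {f} (xs : Vec ℕ f) → (∀ i → lookup xs i < n) →
           map (λ x → does (k ≟ x)) xs ≡ replicate f false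
  zeros¹ []       _    = refl
  zeros¹ (x ∷ xs) xs<n = cong₂ _∷_
    (det (proof (k ≟ x)) (ofⁿ λ { refl → <⇒≱ (xs<n zero) n≤k })) (zeros¹ xs (xs<n ∘ suc))
  zeros² : ∀ {s} (Xs : Vec FinSet s) → (∀ j → Below n (lookup Xs j)) →
           map (λ X → does (k ∈? X)) Xs ≡ replicate s false
  zeros² []       _    = refl
  zeros² (X ∷ Xs) Xs<n = cong₂ _∷_
    (det (proof (k ∈? X)) (ofⁿ λ k∈X → <⇒≱ (Xs<n zero k k∈X) n≤k)) (zeros² Xs (Xs<n ∘ suc))

Relation : ℕ → ℕ → Set₁
Relation f s = Vec ℕ f → Vec FinSet s → Set

-- Demanded at every sufficient length `n`, because a witness for a quantifier may force a longer
-- word than the free variables do.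
Recognises : DFA (Letter f s) → Relation f s → Set
Recognises 𝔸 P = ∀ xs Xs n → Bounded n xs Xs → Reflects (P xs Xs) (accept 𝔸 (letter xs Xs) n)

Recognisable : Relation f s → Set₁
Recognisable P = Σ[ 𝔸 ∈ DFA _ ] Recognises 𝔸 P

private variable
  P Q : Relation f s

recognisable-∈ : ∀ i j → Recognisable {f} {s} (λ xs Xs → lookup xs i ∈ lookup Xs j)
recognisable-∈ i j = scan both both proj₁ , λ xs Xs n (xs<n , Xs<n) → Reflects-⇔
  (mk⇔ (λ (k , k<n , kij) → let ki , kj = to T-∧ kij in
          subst (_∈ lookup Xs j) (reflected (proof (k ≟ lookup xs i)) (subst T (lookup-map i _ xs) ki))
            (reflected (proof (k ∈? lookup Xs j)) (subst T (lookup-map j _ Xs) kj)))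
       (λ i∈j → lookup xs i , xs<n i , from T-∧
          ( subst T (sym (lookup-map i _ xs)) (reflect (proof (_ ≟ lookup xs i)) refl)
          , subst T (sym (lookup-map j _ Xs)) (reflect (proof (_ ∈? lookup Xs j)) i∈j))))
  (scan-occurs both both proj₁ (letter xs Xs) n)
  where
  both : Letter _ _ → Bool
  both (v , w) = lookup v i ∧ lookup w j

recognisable-< : ∀ i j → Recognisable {f} {s} (λ xs Xs → lookup xs i < lookup xs j)
recognisable-< i j = scan (at i) (at j) proj₂ , λ xs Xs n (xs<n , _) → Reflects-⇔
  (mk⇔ (λ (k , l , k<l , l<n , ki , lj) →
          subst₂ _<_ (reflected (proof (k ≟ lookup xs i)) (subst T (lookup-map i _ xs) ki))
                     (reflected (proof (l ≟ lookup xs j)) (subst T (lookup-map j _ xs) lj)) k<l)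
       (λ i<j → lookup xs i , lookup xs j , i<j , xs<n j
          , subst T (sym (lookup-map i _ xs)) (reflect (proof (_ ≟ lookup xs i)) refl)
          , subst T (sym (lookup-map j _ xs)) (reflect (proof (_ ≟ lookup xs j)) refl)))
  (scan-precedes (at i) (at j) proj₂ (letter xs Xs) n)
  where
  at : Fin _ → Letter _ _ → Bool
  at i (v , _) = lookup v i

recognisable-¬ : Recognisable P → Recognisable (λ xs Xs → ¬ P xs Xs)
recognisable-¬ (𝔸 , rec) = complement 𝔸 , λ xs Xs n bd →
  subst (Reflects _) (sym (accept-complement 𝔸 _ n)) (¬-reflects (rec xs Xs n bd))

recognisable-binary : {_⊙_ : Set → Set → Set} (_∙_ : Bool → Bool → Bool) →
  (∀ {A B a b} → Reflects A a → Reflects B b → Reflects (A ⊙ B) (a ∙ b)) →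
  Recognisable P → Recognisable Q → Recognisable (λ xs Xs → P xs Xs ⊙ Q xs Xs)
recognisable-binary _∙_ reflects (𝔸 , rec𝔸) (𝔹 , rec𝔹) = product _∙_ 𝔸 𝔹 , λ xs Xs n bd →
  subst (Reflects _) (sym (accept-product _∙_ 𝔸 𝔹 _ n))
    (reflects (rec𝔸 xs Xs n bd) (rec𝔹 xs Xs n bd))

Bounded-∷¹ : ∀ {m x} (xs : Vec ℕ f) (Xs : Vec FinSet s) → n ≤ m → x < m →
             Bounded n xs Xs → Bounded m (x ∷ xs) Xs
Bounded-∷¹ _ _ n≤m x<m (xs<n , Xs<n) =
  (λ { zero → x<m ; (suc i) → <-≤-trans (xs<n i) n≤m }) ,
  (λ j y y∈ → <-≤-trans (Xs<n j y y∈) n≤m)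

Bounded-∷² : ∀ {m X} (xs : Vec ℕ f) (Xs : Vec FinSet s) → n ≤ m → Below m X →
             Bounded n xs Xs → Bounded m xs (X ∷ Xs)
Bounded-∷² _ _ n≤m X<m (xs<n , Xs<n) =
  (λ i → <-≤-trans (xs<n i) n≤m) ,
  (λ { zero → X<m ; (suc j) y y∈ → <-≤-trans (Xs<n j y y∈) n≤m })

recognisable-∃² : Recognisable {f} {suc s} P → Recognisable {f} {s} (λ xs Xs → ∃[ X ] P xs (X ∷ Xs))
recognisable-∃² {P = P} (𝔸 , rec) = project , λ xs Xs n bd →
  let acc = accept-project (letter xs Xs) n (letter-blank xs Xs bd) in
  fromEquivalence (sound xs Xs n bd ∘ to acc) (from acc ∘ complete xs Xs n bd)
  where
  open Projection (λ b (v , w) → v , b ∷ w) (replicate _ false , replicate _ false) 𝔸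

  sound : ∀ xs Xs n → Bounded n xs Xs →
          (∃₂ λ u m → n ≤ m × T (accept 𝔸 (track u (letter xs Xs)) m)) → ∃[ X ] P xs (X ∷ Xs)
  sound xs Xs n bd (u , m , n≤m , acc) = X , reflected
    (rec xs (X ∷ Xs) m (Bounded-∷² xs Xs n≤m (λ x x∈ → proj₁ (to (∈-fromBits u m) x∈)) bd))
    (subst (T ∘ final 𝔸) (run-cong 𝔸 m λ k k<m →
      cong (λ b → _ , b ∷ _) (det (Reflects-⇔ (u⇔X k k<m) (T-reflects (u k))) (proof (k ∈? X)))) acc)
    where
    X = fromBits u m
    u⇔X : ∀ k → k < m → T (u k) ⇔ k ∈ X
    u⇔X k k<m = mk⇔ (λ uk → from (∈-fromBits u m) (k<m , uk)) (λ k∈ → proj₂ (to (∈-fromBits u m) k∈))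

  complete : ∀ xs Xs n → Bounded n xs Xs → (∃[ X ] P xs (X ∷ Xs)) →
             ∃₂ λ u m → n ≤ m × T (accept 𝔸 (track u (letter xs Xs)) m)
  complete xs Xs n bd (X , p) with l , X<l ← below X =
    (λ k → does (k ∈? X)) , n ⊔ l , m≤m⊔n n l , reflect
      (rec xs (X ∷ Xs) (n ⊔ l)
        (Bounded-∷² xs Xs (m≤m⊔n n l) (λ x x∈ → <-≤-trans (X<l x x∈) (m≤n⊔m n l)) bd)) p

-- A guessed track encodes a number only if it marks exactly one position. Before projecting, the
-- automaton is intersected with one checking that a mark occurs and that no mark precedes another.
recognisable-∃¹ : Recognisable {suc f} {s} P → Recognisable {f} {s} (λ xs Xs → ∃[ x ] P (x ∷ xs) Xs)
recognisable-∃¹ {P = P} (𝔸 , rec) = project , λ xs Xs n bd →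
  let acc = accept-project (letter xs Xs) n (letter-blank xs Xs bd) in
  fromEquivalence (sound xs Xs n bd ∘ to acc) (from acc ∘ complete xs Xs n bd)
  where
  mark : Letter (suc _) _ → Bool
  mark (v , _) = head v

  once = λ ((occurs , repeats) : Bool × Bool) → occurs ∧ not repeats

  𝔹 = product _∧_ 𝔸 (scan mark mark once)

  open Projection (λ b (v , w) → b ∷ v , w) (replicate _ false , replicate _ false) 𝔹

  reflects-once : ∀ w m → Reflects (Occurs mark w m × ¬ Precedes mark mark w m)
                                   (accept (scan mark mark once) w m)
  reflects-once w m = scan-occurs mark mark once w m
    ×-reflects ¬-reflects (scan-precedes mark mark once w m)

  sound : ∀ xs Xs n → Bounded n xs Xs →
          (∃₂ λ u m → n ≤ m × T (accept 𝔹 (track u (letter xs Xs)) m)) → ∃[ x ] P (x ∷ xs) Xs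
  sound xs Xs n bd (u , m , n≤m , acc)
    with acc𝔸 , acc-once ← to T-∧
      (subst T (accept-product _∧_ 𝔸 (scan mark mark once) (track u (letter xs Xs)) m) acc)
    with (x , x<m , ux) , unique ← reflected (reflects-once (track u (letter xs Xs)) m) acc-once =
    x , reflected (rec (x ∷ xs) Xs m (Bounded-∷¹ xs Xs n≤m x<m bd))
      (subst (T ∘ final 𝔸) (run-cong 𝔸 m λ k k<m →
        cong (λ b → b ∷ _ , _) (det (Reflects-⇔ (u⇔x k k<m) (T-reflects (u k))) (proof (k ≟ x)))) acc𝔸)
    where
    u⇔x : ∀ k → k < m → T (u k) ⇔ k ≡ x
    u⇔x k k<m = mk⇔ to′ λ { refl → ux }
      where
      to′ : T (u k) → k ≡ x
      to′ uk with <-cmp k x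
      ... | tri< k<x _ _ = contradiction (k , x , k<x , x<m , uk , ux) unique
      ... | tri≈ _ k≡x _ = k≡x
      ... | tri> _ _ x<k = contradiction (x , k , x<k , k<m , ux , uk) unique

  complete : ∀ xs Xs n → Bounded n xs Xs → (∃[ x ] P (x ∷ xs) Xs) →
             ∃₂ λ u m → n ≤ m × T (accept 𝔹 (track u (letter xs Xs)) m)
  complete xs Xs n bd (x , p) =
    (λ k → does (k ≟ x)) , m , m≤m⊔n n (suc x) ,
    subst T (sym (accept-product _∧_ 𝔸 (scan mark mark once) w m)) (from T-∧
      ( reflect (rec (x ∷ xs) Xs m (Bounded-∷¹ xs Xs (m≤m⊔n n (suc x)) x<m bd)) p
      , reflect (reflects-once w m)
          ( (x , x<m , reflect (proof (x ≟ x)) refl)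
          , λ (j , k , j<k , _ , jx , kx) → <⇒≢ j<k
              (trans (reflected (proof (j ≟ x)) jx) (sym (reflected (proof (k ≟ x)) kx))))))
    where
    m   = n ⊔ suc x
    w   = letter (x ∷ xs) Xs
    x<m : x < m
    x<m = m≤n⊔m n (suc x)

bounded : (xs : Vec ℕ f) (Xs : Vec FinSet s) → ∃[ n ] Bounded n xs Xs
bounded xs Xs with k , xs≤k ← upper-bound (lookup xs)
              with l , Xs≤l ← upper-bound (proj₁ ∘ below ∘ lookup Xs) =
  suc k ⊔ l ,
  (λ i → <-≤-trans (s≤s (xs≤k i)) (m≤m⊔n (suc k) l)) ,
  (λ j x x∈ → <-≤-trans (proj₂ (below (lookup Xs j)) x x∈) (≤-trans (Xs≤l j) (m≤n⊔m (suc k) l)))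

recognisable⇒decidable : Recognisable P → ∀ xs Xs → Dec (P xs Xs)
recognisable⇒decidable (𝔸 , rec) xs Xs =
  let n , bd = bounded xs Xs in _ because rec xs Xs n bd

recognisable-⇔ : (∀ xs Xs → P xs Xs ⇔ Q xs Xs) → Recognisable P → Recognisable Q
recognisable-⇔ P⇔Q (𝔸 , rec) = 𝔸 , λ xs Xs n bd → Reflects-⇔ (P⇔Q xs Xs) (rec xs Xs n bd)

¬∃¬⇔∀ : {P : A → Set} → (∀ a → Dec (P a)) → (¬ (∃[ a ] ¬ P a)) ⇔ (∀ a → P a)
¬∃¬⇔∀ P? = mk⇔ (λ none a → decidable-stable (P? a) λ ¬Pa → none (a , ¬Pa))
                (λ all (a , ¬Pa) → ¬Pa (all a))

-- Reduced to negation and projection; replacing ∀ by ¬∃¬ is constructively sound here because a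
-- recognisable relation is decidable.
recognisable-∀¹ : Recognisable {suc f} {s} P → Recognisable {f} {s} (λ xs Xs → ∀ x → P (x ∷ xs) Xs)
recognisable-∀¹ {P = P} P-rec = recognisable-⇔
  (λ xs Xs → ¬∃¬⇔∀ λ x → recognisable⇒decidable {P = P} P-rec (x ∷ xs) Xs)
  (recognisable-¬ {P = λ xs Xs → ∃[ x ] ¬ P (x ∷ xs) Xs}
    (recognisable-∃¹ {P = λ xs Xs → ¬ P xs Xs} (recognisable-¬ {P = P} P-rec)))

recognisable-∀² : Recognisable {f} {suc s} P → Recognisable {f} {s} (λ xs Xs → ∀ X → P xs (X ∷ Xs))
recognisable-∀² {P = P} P-rec = recognisable-⇔
  (λ xs Xs → ¬∃¬⇔∀ λ X → recognisable⇒decidable {P = P} P-rec xs (X ∷ Xs))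
  (recognisable-¬ {P = λ xs Xs → ∃[ X ] ¬ P xs (X ∷ Xs)}
    (recognisable-∃² {P = λ xs Xs → ¬ P xs Xs} (recognisable-¬ {P = P} P-rec)))

recognisable-Sat : (φ : Formula orderSignature f s) →
                   Recognisable (λ xs Xs → Sat ⟨ℕ,<⟩ xs Xs φ)
recognisable-Sat (i ∈' j)                     = recognisable-∈ i j
recognisable-Sat (atom less (i ∷ j ∷ []) []) = recognisable-< i j
recognisable-Sat (¬' φ)   = recognisable-¬ (recognisable-Sat φ)
recognisable-Sat (φ ∧' ψ) =
  recognisable-binary _∧_ _×-reflects_ (recognisable-Sat φ) (recognisable-Sat ψ)
recognisable-Sat (φ ∨' ψ) =
  recognisable-binary _∨_ _⊎-reflects_ (recognisable-Sat φ) (recognisable-Sat ψ)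
recognisable-Sat (φ ⇒' ψ) = recognisable-binary (λ a b → not a ∨ b) _→-reflects_
  (recognisable-Sat φ) (recognisable-Sat ψ)
recognisable-Sat (∃¹ φ)   = recognisable-∃¹ (recognisable-Sat φ)
recognisable-Sat (∀¹ φ)   = recognisable-∀¹ (recognisable-Sat φ)
recognisable-Sat (∃² φ)   = recognisable-∃² (recognisable-Sat φ)
recognisable-Sat (∀² φ)   = recognisable-∀² (recognisable-Sat φ)

-- Periodicity of definable cardinality relations

-- The pigeonhole principle is applied to the iterates of `g` as whole maps, not to a single orbit,
-- so that `N` and `p` do not depend on the starting point `a`.
eventually-periodic : Finite A → (g : A → A) →
  ∃₂ λ N p → ∀ a k → N ≤ k → fold a g k ≡ fold a g (k + suc p)
eventually-periodic {A = A} fin g =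
  let i , j , i<j , codes≡ = pigeonhole (n<1+n _) (code ∘ toℕ) in
  -- The second witness is j - i - 1, since the period j - i is written `suc p`.
  toℕ i , toℕ j ∸ suc (toℕ i) , periodic i<j (code-injective (toℕ i) (toℕ j) codes≡)
  where
  code : ℕ → Fin (size fin ^ size fin)
  code k = funToFin λ x → encode fin (fold (decode fin x) g k)

  code-injective : ∀ k l → code k ≡ code l → ∀ a → fold a g k ≡ fold a g l
  code-injective k l eq a = trans (sym (decoded k)) (trans (cong at-a eq) (decoded l))
    where
    at-a : Fin (size fin ^ size fin) → A
    at-a c = decode fin (finToFun c (encode fin a))
    decoded : ∀ k → at-a (code k) ≡ fold a g k
    decoded k = trans (cong (decode fin) (finToFun-funToFin _ (encode fin a)))
      (trans (decode-encode fin _) (cong (λ a → fold a g k) (decode-encode fin a)))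

  periodic : ∀ {i j} → i < j → (∀ a → fold a g i ≡ fold a g j) →
             ∀ a k → i ≤ k → fold a g k ≡ fold a g (k + suc (j ∸ suc i))
  periodic {i} {j} i<j folds≡ a k i≤k = begin
    fold a g k                     ≡⟨ cong (fold a g) (m∸n+n≡m i≤k) ⟨
    fold a g (d + i)               ≡⟨ fold-+ a g d ⟩
    fold (fold a g i) g d          ≡⟨ cong (λ b → fold b g d) (folds≡ a) ⟩
    fold (fold a g j) g d          ≡⟨ fold-+ a g d ⟨
    fold a g (d + j)               ≡⟨ cong (fold a g ∘ (d +_)) (m+[n∸m]≡n i<j) ⟨
    fold a g (d + suc (i + e))     ≡⟨ cong (fold a g ∘ (d +_)) (+-suc i e) ⟨
    fold a g (d + (i + suc e))     ≡⟨ cong (fold a g) (+-assoc d i (suc e)) ⟨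
    fold a g (d + i + suc e)       ≡⟨ cong (λ m → fold a g (m + suc e)) (m∸n+n≡m i≤k) ⟩
    fold a g (k + suc e)           ∎
    where
    open ≡-Reasoning
    d = k ∸ i
    e = j ∸ suc i

-- The lowest positions are read last, so a constant stretch there iterates one map on the state
-- left by the rest of the word.
run-constant-prefix : ∀ {L} (𝔸 : DFA L) {a} w c {n} → (∀ k → k < c → w k ≡ a) →
  run 𝔸 w (c + n) ≡ fold (run 𝔸 (λ k → w (c + k)) n) (step 𝔸 a) c
run-constant-prefix 𝔸 w zero    w≡a = refl
run-constant-prefix 𝔸 w (suc c) w≡a = cong₂ (step 𝔸) (w≡a 0 z<s)
  (run-constant-prefix 𝔸 (w ∘ suc) c λ k k<c → w≡a (suc k) (s<s k<c))

lookup-[]≔ : ∀ (C : Fin n → A → Set) (xs : Vec A n) i {y} → C i y →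
             (∀ j → j ≢ i → C j (lookup xs j)) → ∀ j → C j (lookup (xs [ i ]≔ y) j)
lookup-[]≔ C xs i {y} Cy Cxs j with j ≟ᶠ i
... | yes refl = subst (C i) (sym (lookup∘update i xs y)) Cy
... | no  j≢i  = subst (C j) (sym (lookup∘update′ j≢i xs y)) (Cxs j j≢i)

-- Places i below c and all other positions at or above c: changing the
-- cardinality of the i-th set then only changes the length of a constant prefix.
module Spread {n} (i : Fin n) where

  block : Bool → ℕ → ℕ → FinSet
  block true  c m = segment 0 c
  block false c m = segment c m

  spread : Vec FinSet n → ℕ → Vec FinSet n
  spread Xs c = tabulate λ j → block (does (j ≟ᶠ i)) c ∣ lookup Xs j ∣

  prefix : Letter 0 n
  prefix = [] , tabulate λ j → does (j ≟ᶠ i)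

  card-spread : ∀ Xs {c Y} → ∣ Y ∣ ≡ c → ∀ j → ∣ lookup (Xs [ i ]≔ Y) j ∣ ≡ ∣ lookup (spread Xs c) j ∣
  card-spread Xs {c} ∣Y∣≡c j = trans
    (lookup-[]≔ (λ j X → ∣ X ∣ ≡ ∣ block (does (j ≟ᶠ i)) c ∣ lookup Xs j ∣ ∣) Xs i
      (trans ∣Y∣≡c (trans (sym (card-segment 0 c))
        (cong (λ b → ∣ block b c ∣ lookup Xs i ∣ ∣) (det (ofʸ refl) (proof (i ≟ᶠ i))))))
      (λ j j≢i → trans (sym (card-segment c _))
        (cong (λ b → ∣ block b c ∣ lookup Xs j ∣ ∣) (det (ofⁿ j≢i) (proof (j ≟ᶠ i)))))
      j)
    (cong ∣_∣ (sym (lookup∘tabulate _ j)))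

  block-low : ∀ b {c m k} → k < c → does (k ∈? block b c m) ≡ b
  block-low true  {c} {m} {k} k<c =
    det (proof (k ∈? segment 0 c)) (ofʸ (from ∈-segment (z≤n , k<c)))
  block-low false {c} {m} {k} k<c =
    det (proof (k ∈? segment c m)) (ofⁿ λ k∈ → <⇒≱ k<c (proj₁ (to ∈-segment k∈)))

  -- From `c` upwards the `i`-th set has no elements, just as for `c = 0`, and the other sets are
  -- translates of their versions for `c = 0`.
  block-high : ∀ b c m k → does ((c + k) ∈? block b c m) ≡ does (k ∈? block b 0 m)
  block-high true  c m k = trans
    (det (proof ((c + k) ∈? block true c m))
         (ofⁿ λ k∈ → <⇒≱ (proj₂ (to (∈-segment {0} {c}) k∈)) (m≤m+n c k)))
    (det (ofⁿ λ ()) (proof (k ∈? block true 0 m)))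
  block-high false c m k = det (proof ((c + k) ∈? segment c m))
    (Reflects-⇔ (mk⇔ (λ k∈ → from ∈-segment (m≤m+n c k , +-monoʳ-< c (proj₂ (to (∈-segment {0}) k∈))))
                     (λ k∈ → from ∈-segment (z≤n , +-cancelˡ-< c k m (proj₂ (to ∈-segment k∈)))))
                (proof (k ∈? segment 0 m)))

  block-below : ∀ b {c m l} → m ≤ l → Below (c + l) (block b c m)
  block-below true  {c} m≤l x x∈ = <-≤-trans (proj₂ (to (∈-segment {0} {c}) x∈)) (m≤m+n c _)
  block-below false {c} m≤l x x∈ = <-≤-trans (proj₂ (to ∈-segment x∈)) (+-monoʳ-≤ c m≤l)

  letter-spread : ∀ Xs c k → letter [] (spread Xs c) k ≡
    ([] , tabulate λ j → does (k ∈? block (does (j ≟ᶠ i)) c ∣ lookup Xs j ∣))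
  letter-spread Xs c k = cong ([] ,_) (sym (tabulate-∘ _ _))

  letter-low : ∀ Xs {c k} → k < c → letter [] (spread Xs c) k ≡ prefix
  letter-low Xs {c} {k} k<c = trans (letter-spread Xs c k)
    (cong ([] ,_) (tabulate-cong λ j → block-low (does (j ≟ᶠ i)) k<c))

  letter-high : ∀ Xs c k → letter [] (spread Xs c) (c + k) ≡ letter [] (spread Xs 0) k
  letter-high Xs c k = trans (letter-spread Xs c (c + k)) (trans
    (cong ([] ,_) (tabulate-cong λ j → block-high (does (j ≟ᶠ i)) c _ k))
    (sym (letter-spread Xs 0 k)))

  -- One `l` serves every `c`, so the runs for different `c` share their part above `c`.
  spread-bounded : ∀ Xs → ∃[ l ] (∀ c → Bounded (c + l) [] (spread Xs c))
  spread-bounded Xs with l , Xs≤l ← upper-bound (∣_∣ ∘ lookup Xs) =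
    l , λ c → (λ ()) , λ j → subst (Below (c + l)) (sym (lookup∘tabulate _ j))
                                   (block-below (does (j ≟ᶠ i)) (Xs≤l j))

  accept-spread : ∀ Xs 𝔸 l → let q = run 𝔸 (letter [] (spread Xs 0)) l in
    ∀ c → accept 𝔸 (letter [] (spread Xs c)) (c + l) ≡ final 𝔸 (fold q (step 𝔸 prefix) c)
  accept-spread Xs 𝔸 l c = cong (final 𝔸) (trans
    (run-constant-prefix 𝔸 (letter [] (spread Xs c)) c λ k → letter-low Xs)
    (cong (λ q → fold q (step 𝔸 prefix) c) (run-cong 𝔸 l λ k _ → letter-high Xs c k)))

-- The threshold and the period are uniform in the other arguments; writing the period as `suc p`
-- keeps it positive.
Periodic : SetRelation n → Fin n → Set
Periodic R i = ∃₂ λ N p → ∀ Xs Y → N ≤ ∣ lookup Xs i ∣ → ∣ Y ∣ ≡ ∣ lookup Xs i ∣ + suc p →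
               R Xs ⇔ R (Xs [ i ]≔ Y)

-- Up to cardinalities, updating `Xs` at `i` by `Y` gives `spread Xs ∣ Y ∣`. There the answer is
-- read off after iterating `step 𝔸 prefix` as often as `∣ Y ∣` says, from a state that does not
-- depend on `Y`.
recognisable⇒periodic : {R : SetRelation n} → IsCardinalityRelation R →
  Recognisable (λ (_ : Vec ℕ 0) → R) → ∀ i → Periodic R i
recognisable⇒periodic {n = n} {R} card (𝔸 , rec) i =
  let N , p , periodic = eventually-periodic (finite 𝔸) (step 𝔸 prefix) in
  N , p , λ Xs Y N≤∣Xᵢ∣ ∣Y∣≡ →
    -- `Xs` is its own update at `i` by its own entry, so `spread⇔` serves both sides.
    ⇔-trans (subst (λ Zs → R Zs ⇔ T (final 𝔸 (fold (tail Xs) (step 𝔸 prefix) ∣ lookup Xs i ∣)))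
                   ([]≔-lookup Xs i) (spread⇔ Xs (lookup Xs i)))
      (⇔-sym (subst (λ q → R (Xs [ i ]≔ Y) ⇔ T (final 𝔸 q))
        (trans (cong (fold (tail Xs) (step 𝔸 prefix)) ∣Y∣≡)
               (sym (periodic (tail Xs) ∣ lookup Xs i ∣ N≤∣Xᵢ∣)))
        (spread⇔ Xs Y)))
  where
  open Spread i

  tail : Vec FinSet n → State 𝔸
  tail Xs = run 𝔸 (letter [] (spread Xs 0)) (proj₁ (spread-bounded Xs))

  spread⇔ : ∀ Xs Y → R (Xs [ i ]≔ Y) ⇔ T (final 𝔸 (fold (tail Xs) (step 𝔸 prefix) ∣ Y ∣))
  spread⇔ Xs Y = ⇔-trans (card _ _ (card-spread Xs refl)) (mk⇔
    (subst T (accept-spread Xs 𝔸 l ∣ Y ∣) ∘ reflect rec-spread)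
    (reflected rec-spread ∘ subst T (sym (accept-spread Xs 𝔸 l ∣ Y ∣))))
    where
    l = proj₁ (spread-bounded Xs)
    rec-spread = rec [] (spread Xs ∣ Y ∣) (∣ Y ∣ + l) (proj₂ (spread-bounded Xs) ∣ Y ∣)

-- Formula combinators

module _ {σ : Signature} where

  -- Truth is not primitive and there may be no variable in scope, so the tautology binds its own.
  ⊤' : Formula σ f s
  ⊤' = ∀² (∀¹ (zero ∈' zero ⇒' zero ∈' zero))

  infix 4 _⇔'_

  _⇔'_ : Formula σ f s → Formula σ f s → Formula σ f s
  φ ⇔' ψ = (φ ⇒' ψ) ∧' (ψ ⇒' φ)

  ⋀ ⋁ : ∀ {m} → (Fin m → Formula σ f s) → Formula σ f s
  ⋀ {m = zero}  φ = ⊤'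
  ⋀ {m = suc m} φ = φ zero ∧' ⋀ (φ ∘ suc)
  ⋁ {m = zero}  φ = ¬' ⊤'
  ⋁ {m = suc m} φ = φ zero ∨' ⋁ (φ ∘ suc)

  ∀²s : ∀ m → Formula σ f (m + s) → Formula σ f s
  ∀²s zero    φ = φ
  ∀²s (suc m) φ = ∀²s m (∀² φ)

  module _ (M : Structure σ) {xs : Vec ℕ f} {Xs : Vec FinSet s} where

    Sat-⋀ : ∀ {m} (φ : Fin m → Formula σ f s) →
            Sat M xs Xs (⋀ φ) ⇔ (∀ i → Sat M xs Xs (φ i))
    Sat-⋀ {zero}  φ = mk⇔ (λ _ ()) (λ _ _ _ → id)
    Sat-⋀ {suc m} φ = mk⇔
      (λ { (p , ps) zero → p ; (p , ps) (suc i) → to (Sat-⋀ (φ ∘ suc)) ps i })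
      (λ ps → ps zero , from (Sat-⋀ (φ ∘ suc)) (ps ∘ suc))

    Sat-⋁ : ∀ {m} (φ : Fin m → Formula σ f s) →
            Sat M xs Xs (⋁ φ) ⇔ (∃[ i ] Sat M xs Xs (φ i))
    Sat-⋁ {zero}  φ = mk⇔ (λ ¬⊤ → contradiction (λ _ _ → id) ¬⊤) λ ()
    Sat-⋁ {suc m} φ = mk⇔
      [ (zero ,_) , (λ ps → let i , p = to (Sat-⋁ (φ ∘ suc)) ps in suc i , p) ]′
      λ { (zero , p) → inj₁ p ; (suc i , p) → inj₂ (from (Sat-⋁ (φ ∘ suc)) (i , p)) }

    Sat-∀²s : ∀ {m} {φ : Formula σ f (m + s)} →
              Sat M xs Xs (∀²s m φ) ⇔ (∀ (Zs : Vec FinSet m) → Sat M xs (Zs ++ Xs) φ)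
    Sat-∀²s {zero}  = mk⇔ (λ p → λ { [] → p }) (λ p → p [])
    Sat-∀²s {suc m} = mk⇔ (λ p → λ { (Z ∷ Zs) → to Sat-∀²s p Zs Z })
                          (λ p → from Sat-∀²s λ Zs Z → p (Z ∷ Zs))

-- Defining the cardinality of a set up to a finite transition system

-- Counting by truncation lets `card-cong` give the full cardinality once `k` lies above all of `X`.
count : FinSet → ℕ → ℕ
count X k = ∣ fromBits (λ x → does (x ∈? X)) k ∣

module _ (X : FinSet) (k : ℕ) where
  private
    ∈X? : Decidable (λ x → T (does (x ∈? X)))
    ∈X? x = T? (does (x ∈? X))

    count-suc : count X (suc k) ≡ count X k + length (filter ∈X? (k ∷ []))
    count-suc = trans (cong (length ∘ filter ∈X?) (sym (upTo-∷ʳ k)))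
      (trans (cong length (filter-++ ∈X? (upTo k) (k ∷ []))) (length-++ (filter ∈X? (upTo k))))

  count-∈ : k ∈ X → count X (suc k) ≡ suc (count X k)
  count-∈ k∈X = trans count-suc (trans
    (cong (λ ks → count X k + length ks) (filter-accept ∈X? (reflect (proof (k ∈? X)) k∈X)))
    (+-comm _ 1))

  count-∉ : ¬ k ∈ X → count X (suc k) ≡ count X k
  count-∉ k∉X = trans count-suc (trans
    (cong (λ ks → count X k + length ks) (filter-reject ∈X? (k∉X ∘ reflected (proof (k ∈? X)))))
    (+-identityʳ _))

count-below : ∀ X {k} → Below k X → count X k ≡ ∣ X ∣
count-below X {k} X<k = card-cong (fromBits bit k) X λ x → mk⇔
  (λ x∈ → reflected (proof (x ∈? X)) (proj₂ (to (∈-fromBits bit k) x∈)))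
  (λ x∈X → from (∈-fromBits bit k) (X<k x x∈X , reflect (proof (x ∈? X)) x∈X))
  where bit = λ x → does (x ∈? X)

infix 7 _<'_

_<'_ : Fin f → Fin f → Formula orderSignature f s
i <' j = atom less (i ∷ j ∷ []) []

module Counting {m} (next : Fin m → Fin m) (start : Fin m) {s} (i : Fin s) (c : Fin m) where

  X : Fin (m + s)
  X = m ↑ʳ i

  Z : Fin m → Fin (m + s)
  Z d = d ↑ˡ s

  -- Zero is not in the signature; it is the position with nothing below it.
  initial' : Formula orderSignature 1 (m + s)
  initial' = ∀¹ (∀¹ (¬' (0F <' 1F)) ⇒' 0F ∈' Z start)

  -- Outside the innermost quantifier, `2F`, `1F`, `0F` are k, a position and its successor, the
  -- latter expressed by having nothing in between. The positions stop below k: otherwise finite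
  -- sets could not meet the premises of `counting'`, which would then hold vacuously.
  transition' : Fin m → Formula orderSignature 1 (m + s)
  transition' d = ∀¹ (∀¹ (1F <' 2F ⇒' 1F <' 0F ⇒' ∀¹ (2F <' 0F ⇒' ¬' (0F <' 1F)) ⇒' 1F ∈' Z d ⇒'
    (1F ∈' X ⇒' 0F ∈' Z (next d)) ∧' (¬' (1F ∈' X) ⇒' 0F ∈' Z d)))

  above' : Formula orderSignature 1 (m + s)
  above' = ∀¹ (0F ∈' X ⇒' 0F <' 1F)

  -- Z d stands for the set of positions k at which the number of elements
  -- of X below k leads from start to d.
  counting' : Formula orderSignature 0 s
  counting' = ∀²s m (∀¹ (initial' ⇒' ⋀ transition' ⇒' above' ⇒' 0F ∈' Z c))

  state : ℕ → Fin m
  state = fold start next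

  module _ (Xs : Vec FinSet s) where
    private X₀ = lookup Xs i

    -- The quantified sets are instantiated with the actual run, truncated after a bound `k` of the
    -- set; the conclusion then names the state of that run at `k`.
    sound : Sat ⟨ℕ,<⟩ [] Xs counting' → state ∣ X₀ ∣ ≡ c
    sound sat = subst (λ k → state k ≡ c) (count-below X₀ X<k) (proj₂ (to (∈Z c) sat-c))
      where
      k   = proj₁ (below X₀)
      X<k = proj₂ (below X₀)
      at : Fin m → ℕ → Bool
      at d x = does (state (count X₀ x) ≟ᶠ d)
      Zs = tabulate λ d → fromBits (at d) (suc k)

      ∈Z : ∀ d {x} → x ∈ lookup (Zs ++ Xs) (Z d) ⇔ (x < suc k × state (count X₀ x) ≡ d)
      ∈Z d {x} rewrite lookup-++ˡ Zs Xs d | lookup∘tabulate (λ d → fromBits (at d) (suc k)) d = mk⇔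
        (λ x∈ → let x≤k , xd = to (∈-fromBits (at d) (suc k)) x∈ in
                x≤k , reflected (proof (state (count X₀ x) ≟ᶠ d)) xd)
        (λ (x≤k , xd) → from (∈-fromBits (at d) (suc k))
                          (x≤k , reflect (proof (state (count X₀ x) ≟ᶠ d)) xd))

      ∈X : ∀ {x} → x ∈ lookup (Zs ++ Xs) X ⇔ x ∈ X₀
      ∈X rewrite lookup-++ʳ Zs Xs i = ⇔-refl

      sat-c : k ∈ lookup (Zs ++ Xs) (Z c)
      sat-c = to (Sat-∀²s ⟨ℕ,<⟩) sat Zs k
        (λ { zero min → from (∈Z start) (z<s , refl) ; (suc x) min → contradiction z<s (min 0) })
        (from (Sat-⋀ ⟨ℕ,<⟩ transition') λ d x y x<k x<y no-between x∈Zd →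
          -- Were `y` larger than `suc x`, then `suc x` would lie strictly between `x` and `y`.
          case ≤-antisym x<y (≮⇒≥ (no-between (suc x) (n<1+n x))) of λ { refl →
            let _ , xd = to (∈Z d) x∈Zd in
            (λ x∈X → from (∈Z (next d))
              (s≤s x<k , trans (cong state (count-∈ X₀ x (to ∈X x∈X))) (cong next xd))) ,
            (λ x∉X → from (∈Z d)
              (s≤s x<k , trans (cong state (count-∉ X₀ x (x∉X ∘ from ∈X))) xd)) })
        (λ x x∈X → X<k x (to ∈X x∈X))

    -- Sets satisfying the premises must contain the actual run up to `k`, by induction on the
    -- position; at `k` all elements have been counted.
    complete : state ∣ X₀ ∣ ≡ c → Sat ⟨ℕ,<⟩ [] Xs counting'
    complete ∣X∣≡c = from (Sat-∀²s ⟨ℕ,<⟩) satisfied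
      where
      satisfied : ∀ Zs → Sat ⟨ℕ,<⟩ [] (Zs ++ Xs)
                  (∀¹ (initial' ⇒' ⋀ transition' ⇒' above' ⇒' 0F ∈' Z c))
      satisfied Zs k init transition X<k = subst (λ d → k ∈ lookup (Zs ++ Xs) (Z d))
        (trans (cong state (count-below X₀ λ x x∈ → X<k x (from ∈X x∈))) ∣X∣≡c) (visits k ≤-refl)
        where
        ∈X : ∀ {x} → x ∈ lookup (Zs ++ Xs) X ⇔ x ∈ X₀
        ∈X rewrite lookup-++ʳ Zs Xs i = ⇔-refl

        visits : ∀ x → x ≤ k → x ∈ lookup (Zs ++ Xs) (Z (state (count X₀ x)))
        visits zero    _   = init 0 λ _ ()
        visits (suc x) x<k
          with on-∈ , on-∉ ← to (Sat-⋀ ⟨ℕ,<⟩ transition') transition (state (count X₀ x))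
                               x (suc x) x<k (n<1+n x) (λ z x<z → ≤⇒≯ x<z) (visits x (<⇒≤ x<k))
          with x ∈? X₀
        ... | yes x∈X = subst (λ l → suc x ∈ lookup (Zs ++ Xs) (Z (state l)))
                              (sym (count-∈ X₀ x x∈X)) (on-∈ (from ∈X x∈X))
        ... | no  x∉X = subst (λ l → suc x ∈ lookup (Zs ++ Xs) (Z (state l)))
                              (sym (count-∉ X₀ x x∉X)) (on-∉ (x∉X ∘ to ∈X))

-- From periodicity to definability

-- The list holds the arguments still to be eliminated and is the induction variable of
-- `periodic⇒definable`.
DependsOn : SetRelation n → List (Fin n) → Set
DependsOn R is = ∀ Xs Ys → (∀ i → i ∈ˡ is → ∣ lookup Xs i ∣ ≡ ∣ lookup Ys i ∣) → R Xs ⇔ R Ys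

-- The class of a cardinality k is k itself below N + p + 1, and otherwise its
-- representative in [N, N + p + 1) modulo the period p + 1.
module Classes (N p : ℕ) where

  modulus : ℕ
  modulus = N + suc p

  N<modulus : N < modulus
  N<modulus = m<m+n N z<s

  next : Fin modulus → Fin modulus
  next c with suc (toℕ c) <? modulus
  ... | yes c+1<m = fromℕ< c+1<m
  ... | no  _     = fromℕ< N<modulus

  class : ℕ → Fin modulus
  class = fold (fromℕ< (≤-<-trans z≤n N<modulus)) next

  -- Here `t` counts the periods removed from `k`; below the threshold `N` none may be removed.
  Represents : Fin modulus → ℕ → Set
  Represents c k = ∃[ t ] k ≡ toℕ c + t * suc p × (t ≡ 0 ⊎ N ≤ toℕ c)

  next-represents : ∀ c k → Represents c k → Represents (next c) (suc k)
  next-represents c k (t , refl , t≡0⊎N≤c) with suc (toℕ c) <? modulus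
  ... | yes c+1<m rewrite toℕ-fromℕ< c+1<m = t , refl , map₂ m≤n⇒m≤1+n t≡0⊎N≤c
  -- The last class wraps around to `N`: its successor is `N + suc p`, and the extra period is moved
  -- into `t`.
  ... | no  c+1≮m rewrite toℕ-fromℕ< N<modulus = suc t ,
    trans (cong (_+ t * suc p) (≤-antisym (toℕ<n c) (≮⇒≥ c+1≮m))) (+-assoc N (suc p) _) ,
    inj₂ ≤-refl

  class-represents : ∀ k → Represents (class k) k
  class-represents zero    = 0 , trans (sym (toℕ-fromℕ< _)) (sym (+-identityʳ _)) , inj₁ refl
  class-represents (suc k) = next-represents (class k) k (class-represents k)

  module _ (R : SetRelation n) (i : Fin n)
           (periodic : ∀ Xs Y → N ≤ ∣ lookup Xs i ∣ → ∣ Y ∣ ≡ ∣ lookup Xs i ∣ + suc p →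
                       R Xs ⇔ R (Xs [ i ]≔ Y)) where

    shift : ∀ Xs a t → N ≤ a →
            R (Xs [ i ]≔ segment 0 a) ⇔ R (Xs [ i ]≔ segment 0 (a + t * suc p))
    shift Xs a zero    N≤a rewrite +-identityʳ a = ⇔-refl
    shift Xs a (suc t) N≤a = ⇔-trans (shift Xs a t N≤a)
      (subst (λ Ys → R Xs′ ⇔ R Ys) ([]≔-idempotent Xs i)
        (periodic Xs′ (segment 0 (a + suc t * suc p))
          (subst (N ≤_) (sym card′) (≤-trans N≤a (m≤m+n a _)))
          (trans (card-segment 0 _) (trans a+p+k (cong (_+ suc p) (sym card′))))))
      where
      k   = a + t * suc p
      Xs′ = Xs [ i ]≔ segment 0 k
      card′ : ∣ lookup Xs′ i ∣ ≡ k
      card′ = trans (cong ∣_∣ (lookup∘update i Xs _)) (card-segment 0 k)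
      a+p+k : a + suc t * suc p ≡ k + suc p
      a+p+k = trans (cong (a +_) (+-comm (suc p) (t * suc p))) (sym (+-assoc a _ _))

    replace-by-class : ∀ Xs c k → Represents c k →
                       R (Xs [ i ]≔ segment 0 (toℕ c)) ⇔ R (Xs [ i ]≔ segment 0 k)
    replace-by-class Xs c _ (t , refl , inj₁ refl) rewrite +-identityʳ (toℕ c) = ⇔-refl
    replace-by-class Xs c _ (t , refl , inj₂ N≤c)  = shift Xs (toℕ c) t N≤c

-- Takes `i` off the dependency list once the `i`-th entry is frozen.
card-fixed : ∀ (Xs Ys : Vec FinSet n) i {Y is} →
  (∀ j → j ∈ˡ is → ∣ lookup Xs j ∣ ≡ ∣ lookup Ys j ∣) →
  ∀ j → j ∈ˡ (i ∷ is) → ∣ lookup (Xs [ i ]≔ Y) j ∣ ≡ ∣ lookup (Ys [ i ]≔ Y) j ∣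
card-fixed Xs Ys i {Y} cards j j∈ with j ≟ᶠ i
... | yes refl = cong ∣_∣ (trans (lookup∘update i Xs Y) (sym (lookup∘update i Ys Y)))
... | no  j≢i with j∈
...   | here j≡i   = contradiction j≡i j≢i
...   | there j∈is = trans (cong ∣_∣ (lookup∘update′ j≢i Xs Y))
                       (trans (cards j j∈is) (cong ∣_∣ (sym (lookup∘update′ j≢i Ys Y))))

card-update : ∀ (Xs : Vec FinSet n) i {Y Z} → ∣ Y ∣ ≡ ∣ Z ∣ →
              ∀ j → ∣ lookup (Xs [ i ]≔ Y) j ∣ ≡ ∣ lookup (Xs [ i ]≔ Z) j ∣
card-update Xs i {Y} {Z} ∣Y∣≡∣Z∣ j with j ≟ᶠ i
... | yes refl = trans (cong ∣_∣ (lookup∘update i Xs Y))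
                   (trans ∣Y∣≡∣Z∣ (cong ∣_∣ (sym (lookup∘update i Xs Z))))
... | no  j≢i  = cong ∣_∣ (trans (lookup∘update′ j≢i Xs Y) (sym (lookup∘update′ j≢i Xs Z)))

-- If `j` is `i`, freezing overwrites the change at `j`; otherwise the two updates commute.
periodic-fixed : ∀ (R : SetRelation n) i S {j} → Periodic R j → Periodic (λ Xs → R (Xs [ i ]≔ S)) j
periodic-fixed R i S {j} (N , p , periodic) = N , p , fixed
  where
  fixed : ∀ Xs Y → N ≤ ∣ lookup Xs j ∣ → ∣ Y ∣ ≡ ∣ lookup Xs j ∣ + suc p →
          R (Xs [ i ]≔ S) ⇔ R ((Xs [ j ]≔ Y) [ i ]≔ S)
  fixed Xs Y N≤ ∣Y∣≡ with j ≟ᶠ i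
  ... | yes refl = subst (λ Zs → R (Xs [ i ]≔ S) ⇔ R Zs) (sym ([]≔-idempotent Xs i)) ⇔-refl
  ... | no  j≢i  = subst (λ Zs → R (Xs [ i ]≔ S) ⇔ R Zs) ([]≔-commutes Xs i j (j≢i ∘ sym))
    (periodic (Xs [ i ]≔ S) Y (subst (λ X → N ≤ ∣ X ∣) (sym Xⱼ) N≤)
              (subst (λ X → ∣ Y ∣ ≡ ∣ X ∣ + suc p) (sym Xⱼ) ∣Y∣≡))
    where
    Xⱼ : lookup (Xs [ i ]≔ S) j ≡ lookup Xs j
    Xⱼ = lookup∘update′ j≢i Xs S

-- Splits on the finitely many classes of the cardinality of the `i`-th set. Within a class, `R`
-- agrees with the relation whose `i`-th argument is frozen to a representative, and that relation
-- depends on `is` only. A relation depending on no argument is constant, and decidability selects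
-- its truth value.
periodic⇒definable : ∀ is (R : SetRelation n) → DependsOn R is → Decidable R →
                     (∀ i → Periodic R i) → Definable ⟨ℕ,<⟩ R
periodic⇒definable {n} [] R depends R? periodic with R? (replicate n (segment 0 0))
... | yes r = ⊤' , λ Xs → mk⇔ (λ _ → to (depends _ Xs λ _ ()) r) (λ _ _ _ → id)
... | no ¬r = ¬' ⊤' , λ Xs → mk⇔ (λ ¬⊤ → contradiction (λ _ _ → id) ¬⊤)
                                 (λ r → contradiction (to (depends Xs _ λ _ ()) r) ¬r)
periodic⇒definable {n} (i ∷ is) R depends R? periodic with N , p , periodicᵢ ← periodic i =
  ⋁ formula , λ Xs → mk⇔ (sound Xs ∘ to (Sat-⋁ ⟨ℕ,<⟩ formula))
                             (from (Sat-⋁ ⟨ℕ,<⟩ formula) ∘ complete Xs)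
  where
  open Classes N p

  Rᶜ : Fin modulus → SetRelation n
  Rᶜ c Xs = R (Xs [ i ]≔ segment 0 (toℕ c))

  Rᶜ-definable : ∀ c → Definable ⟨ℕ,<⟩ (Rᶜ c)
  Rᶜ-definable c = periodic⇒definable is (Rᶜ c)
    (λ Xs Ys cards → depends _ _ (card-fixed Xs Ys i cards))
    (λ Xs → R? _)
    (λ j → periodic-fixed R i (segment 0 (toℕ c)) (periodic j))

  formula : Fin modulus → Formula orderSignature 0 n
  formula c = Counting.counting' next (class 0) i c ∧' proj₁ (Rᶜ-definable c)

  R⇔Rᶜ : ∀ Xs → R Xs ⇔ Rᶜ (class ∣ lookup Xs i ∣) Xs
  R⇔Rᶜ Xs = ⇔-trans
    (depends Xs _ λ j _ → lookup-[]≔ (λ j X → ∣ lookup Xs j ∣ ≡ ∣ X ∣) Xs i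
      (sym (card-segment 0 _)) (λ _ _ → refl) j)
    (⇔-sym (replace-by-class R i periodicᵢ Xs _ _ (class-represents ∣ lookup Xs i ∣)))

  sound : ∀ Xs → (∃[ c ] Sat ⟨ℕ,<⟩ [] Xs (formula c)) → R Xs
  -- Started at `class 0`, the transition system of `Counting` computes `class`, so `c` is the class
  -- of the `i`-th cardinality.
  sound Xs (c , counted , sat) with refl ← Counting.sound next (class 0) i c Xs counted =
    from (R⇔Rᶜ Xs) (to (proj₂ (Rᶜ-definable c) Xs) sat)

  complete : ∀ Xs → R Xs → ∃[ c ] Sat ⟨ℕ,<⟩ [] Xs (formula c)
  complete Xs r = let c = class ∣ lookup Xs i ∣ in
    c , Counting.complete next (class 0) i c Xs refl ,
    from (proj₂ (Rᶜ-definable c) Xs) (to (R⇔Rᶜ Xs) r)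

-- The sentence

module Characterisation (n : ℕ) where

  private
    Φ : ℕ → ℕ → Set
    Φ = Formula (orderRelSignature n)

  infix 7 _<″_

  _<″_ : Fin f → Fin f → Φ f s
  i <″ j = atom less (i ∷ j ∷ []) []

  decided' : Φ 0 0
  decided' = ∀²s n (atom rel [] (tabulate (_↑ˡ 0)) ∨' ¬' atom rel [] (tabulate (_↑ˡ 0)))

  arguments : Vec (Fin (suc (n + 0))) n
  arguments = tabulate (suc ∘ (_↑ˡ 0))

  -- The first-order variables 0F, 1F, 2F are b, N, p; the guards say that
  -- b ≥ N, Xᵢ = [p, b) and Y = [0, b).
  shifted' : Fin n → Φ 3 (suc (n + 0))
  shifted' i = ¬' (0F <″ 1F)
    ⇒' ∀¹ (0F ∈' suc (i ↑ˡ 0) ⇔' (¬' (0F <″ 3F) ∧' 0F <″ 1F))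
    ⇒' ∀¹ (0F ∈' 0F ⇔' 0F <″ 1F)
    ⇒' (atom rel [] arguments ⇔' atom rel [] (arguments [ i ]≔ 0F))

  -- The outermost variable is the period, positive because something lies below it; the second is
  -- the threshold.
  periodic' : Fin n → Φ 0 0
  periodic' i = ∃¹ (∃¹ (∃¹ (0F <″ 2F) ∧' ∀²s n (∀² (∀¹ (shifted' i)))))

  sentence : Sentence (orderRelSignature n)
  sentence = decided' ∧' ⋀ periodic'

  lookups : ∀ {m} (θ : Fin n → Fin m) (Zs : Vec FinSet m) (Xs : Vec FinSet n) →
            (∀ i → lookup Zs (θ i) ≡ lookup Xs i) → map (lookup Zs) (tabulate θ) ≡ Xs
  lookups θ Zs Xs eq = trans (sym (tabulate-∘ (lookup Zs) θ))
                             (trans (tabulate-cong eq) (tabulate∘lookup Xs))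

  module _ (R : SetRelation n) (card : IsCardinalityRelation R) where
    private M = ⟨ℕ,<, R ⟩

    variables : ∀ Xs → map (lookup (Xs ++ [])) (tabulate (_↑ˡ 0)) ≡ Xs
    variables Xs = lookups (_↑ˡ 0) (Xs ++ []) Xs (lookup-++ˡ Xs [])

    variables′ : ∀ Y Xs → map (lookup (Y ∷ Xs ++ [])) arguments ≡ Xs
    variables′ Y Xs = lookups (suc ∘ (_↑ˡ 0)) (Y ∷ Xs ++ []) Xs (lookup-++ˡ Xs [])

    variables-[]≔ : ∀ Y Xs i → map (lookup (Y ∷ Xs ++ [])) (arguments [ i ]≔ 0F) ≡ Xs [ i ]≔ Y
    variables-[]≔ Y Xs i = trans (map-[]≔ _ arguments i) (cong (_[ i ]≔ Y) (variables′ Y Xs))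

    Sat-decided : (M ⊨ decided') ⇔ (∀ Xs → R Xs ⊎ ¬ R Xs)
    Sat-decided = mk⇔
      (λ sat Xs → subst (λ Ys → R Ys ⊎ ¬ R Ys) (variables Xs) (to (Sat-∀²s M) sat Xs))
      (λ R? → from (Sat-∀²s M) λ Xs → subst (λ Ys → R Ys ⊎ ¬ R Ys) (sym (variables Xs)) (R? Xs))

    Shifted : Fin n → ℕ → ℕ → Vec FinSet n → FinSet → ℕ → Set
    Shifted i p N Xs Y b = ¬ b < N →
      (∀ x → (x ∈ lookup Xs i → (¬ x < p) × x < b) × ((¬ x < p) × x < b → x ∈ lookup Xs i)) →
      (∀ x → (x ∈ Y → x < b) × (x < b → x ∈ Y)) →
      (R Xs → R (Xs [ i ]≔ Y)) × (R (Xs [ i ]≔ Y) → R Xs)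

    -- Stated as an equality of types, so that the variable lookups are simplified once for both
    -- directions of `Sat-periodic`.
    Sat-shifted : ∀ i p N Xs Y b →
      Sat M (b ∷ N ∷ p ∷ []) (Y ∷ Xs ++ []) (shifted' i) ≡ Shifted i p N Xs Y b
    Sat-shifted i p N Xs Y b rewrite variables′ Y Xs | variables-[]≔ Y Xs i | lookup-++ˡ Xs [] i = refl

    Sat-periodic : ∀ i → (M ⊨ periodic' i) ⇔ Periodic R i
    Sat-periodic i = mk⇔ sound complete
      where
      sound : M ⊨ periodic' i → Periodic R i
      sound (zero  , N , (_ , ()) , sat)
      sound (suc p , N , _ , sat) = N , p , λ Xs Y N≤∣Xᵢ∣ ∣Y∣≡ →
        -- The sentence speaks only of [p, b) against [0, b). Since `R` is a cardinality relation,
        -- the given sets may be exchanged for segments of this shape, with b the period plus `k`.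
        let k   = ∣ lookup Xs i ∣
            Xs′ = Xs [ i ]≔ segment (suc p) k
            Y′  = segment 0 (suc p + k)
            Xs∼Xs′ = card Xs Xs′ (lookup-[]≔ (λ j X → ∣ lookup Xs j ∣ ≡ ∣ X ∣) Xs i
                       (sym (card-segment (suc p) k)) (λ _ _ → refl))
            Ys∼Ys′ = card (Xs [ i ]≔ Y′) (Xs [ i ]≔ Y) (card-update Xs i
                       (trans (card-segment 0 (suc p + k)) (trans (+-comm (suc p) k) (sym ∣Y∣≡))))
            R⇔R′ = subst id (Sat-shifted i (suc p) N Xs′ Y′ (suc p + k))
              (to (Sat-∀²s M) sat Xs′ Y′ (suc p + k))
              (≤⇒≯ (≤-trans N≤∣Xᵢ∣ (m≤n+m k (suc p))))
              (λ x → subst (λ X → (x ∈ X → (¬ x < suc p) × x < suc p + k) ×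
                                   ((¬ x < suc p) × x < suc p + k → x ∈ X))
                (sym (lookup∘update i Xs _))
                ( (λ x∈ → let p≤x , x<b = to ∈-segment x∈ in ≤⇒≯ p≤x , x<b)
                , (λ (x≮p , x<b) → from ∈-segment (≮⇒≥ x≮p , x<b))))
              (λ x → (λ x∈ → proj₂ (to (∈-segment {0}) x∈)) , (λ x<b → from ∈-segment (z≤n , x<b)))
        in ⇔-trans Xs∼Xs′ (⇔-trans (mk⇔ (proj₁ R⇔R′) (proj₂ R⇔R′))
             (subst (λ Zs → R Zs ⇔ R (Xs [ i ]≔ Y)) (sym ([]≔-idempotent Xs i)) Ys∼Ys′))

      complete : Periodic R i → M ⊨ periodic' i
      -- The threshold in the sentence bounds `b`, which is the cardinality after the shift, hence
      -- `N + suc p` in place of `N`.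
      complete (N , p , periodic) = suc p , N + suc p , (0 , z<s) , from (Sat-∀²s M) λ Xs Y b →
        subst id (sym (Sat-shifted i (suc p) (N + suc p) Xs Y b)) λ b≮N+p Xᵢ≐ Y≐ →
          let p≤b  = ≤-trans (m≤n+m (suc p) N) (≮⇒≥ b≮N+p)
              b≡   = m∸n+n≡m p≤b
              ∣Xᵢ∣ = trans (card-cong (lookup Xs i) (segment (suc p) (b ∸ suc p)) λ x → mk⇔
                       (λ x∈ → let x≮p , x<b = proj₁ (Xᵢ≐ x) x∈ in from ∈-segment
                          (≮⇒≥ x≮p , subst (x <_) (sym (m+[n∸m]≡n p≤b)) x<b))
                       (λ x∈ → let p≤x , x<b = to ∈-segment x∈ in proj₂ (Xᵢ≐ x)
                          (≤⇒≯ p≤x , subst (x <_) (m+[n∸m]≡n p≤b) x<b)))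
                       (card-segment (suc p) _)
              ∣Y∣  = trans (card-cong Y (segment 0 b) λ x → mk⇔
                       (λ x∈ → from ∈-segment (z≤n , proj₁ (Y≐ x) x∈))
                       (λ x∈ → proj₂ (Y≐ x) (proj₂ (to (∈-segment {0}) x∈))))
                       (card-segment 0 b)
              R⇔R  = periodic Xs Y
                       (subst (N ≤_) (sym ∣Xᵢ∣) (m+n≤o⇒m≤o∸n N (≮⇒≥ b≮N+p)))
                       (trans ∣Y∣ (trans (sym b≡) (cong (_+ suc p) (sym ∣Xᵢ∣))))
          in to R⇔R , from R⇔R

proposition2p7 : ∀ (n : ℕ) → n ≥ 1 → Σ[ ψ ∈ Sentence (orderRelSignature n) ] (∀ (R : SetRelation n) → IsCardinalityRelation R → (⟨ℕ,<, R ⟩ ⊨ ψ) ⇔ Definable ⟨ℕ,<⟩ R)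
proposition2p7 n _ = sentence , λ R card → mk⇔ (definable R card) (satisfied R card)
  where
  open Characterisation n

  definable : ∀ R → IsCardinalityRelation R → ⟨ℕ,<, R ⟩ ⊨ sentence → Definable ⟨ℕ,<⟩ R
  definable R card (decided , periodic) = periodic⇒definable (allFin n) R
    (λ Xs Ys cards → card Xs Ys λ i → cards i (∈-allFin i))
    (λ Xs → fromSum (to (Sat-decided R card) decided Xs))
    (λ i → to (Sat-periodic R card i) (to (Sat-⋀ ⟨ℕ,<, R ⟩ periodic') periodic i))

  satisfied : ∀ R → IsCardinalityRelation R → Definable ⟨ℕ,<⟩ R → ⟨ℕ,<, R ⟩ ⊨ sentence
  satisfied R card (φ , φ⇔R) =
    from (Sat-decided R card) (λ Xs → toSum (recognisable⇒decidable R-rec [] Xs)) ,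
    from (Sat-⋀ ⟨ℕ,<, R ⟩ periodic')
      (λ i → from (Sat-periodic R card i) (recognisable⇒periodic card R-rec i))
    where
    R-rec : Recognisable (λ (_ : Vec ℕ 0) → R)
    R-rec = recognisable-⇔ (λ { [] → φ⇔R }) (recognisable-Sat φ)
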